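{- Let $F$ be the fork and let $K,K'$ be proper pseudohexes such that $K$ is obtained from $K'$ by $F$-addition. If every $F$-no-edge of $K$ has both of its endpoints in $V(F_K)$, then $F_K$ can be safely reduced.
   Context: Pseudohex. A pseudohex is a bipartite graph $K$ (parallel edges allowed, no loops) whose edges are coloured blue, red and white, which is either empty or satisfies: (i) the blue edges form vertex-disjoint 6-cycles covering $V(K)$, called the hexagons of $K$; if a hexagon is the 6-cycle $v_0v_1\cdots v_5v_0$ we write $\bar{v_i}=v_{i+3}$ (indices mod 6); (ii) for each vertex $x$, $\{x,\bar x\}$ is a red edge of $K$ (further red edges may exist); (iii) the white edges form a perfect matching of $K$. A white edge $e=\{x,y\}$ is real if $\bar e=\{\bar x,\bar y\}$ is also a white edge and the only red edges sharing a vertex with $e$ or $\bar e$ are $\{x,\bar x\}$ and $\{y,\bar y\}$; non-real white edges are derived. An end is a red edge parallel to a white edge. $G^K$ is the graph whose vertices are the hexagons of $K$, two hexagons being adjacent iff some pair of real white edges $e,\bar e$ joins them. $K$ is proper if it has no end and $G^K$ is 2-connected with no cycle of length 2. Reduction. Let $h$ be a hexagon and $N$ one of the two perfect matchings of its blue 6-cycle. For each edge of $N$, let $P$ be the path formed by that edge and the two white edges adjacent to it. If $P$ is not a cycle of length 2, add a new white edge $e_P$ joining the end vertices of $P$, and for each red edge $\{u,w\}$ with $w$ an interior vertex of $P$ add a red edge $\{u,w'\}$ where $w'$ is the endpoint of $e_P$ in the same bipartition class as $w$. If $P$ is a cycle of length 2, then for each red edge $\{u,w\}$ with $w$ an interior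 vertex of $P$ add a red edge $\{u,\bar u\}$. Finally delete the vertices of $h$. Reducing hexagons $h_1,\dots,h_l$ by perfect matchings $N_1,\dots,N_l$ means performing these reductions successively; its contracted paths are the components (paths and cycles) of the subgraph of $K$ formed by $N_1\cup\dots\cup N_l$ together with all white edges having an endpoint in $V(h_1)\cup\dots\cup V(h_l)$. The reduction is safe if every contracted path/cycle contains at most one derived white edge of $K$; a set of hexagons can be safely reduced if some choice of perfect matchings gives a safe reduction. Fork and addition. The fork $F$ is the tree with vertices $x,y,z,a,b$ and edges $zx,zy,za,ab$; the bold fork has one half-edge at each of $x,y,b$. A graph is obtained from $G'$ by addition of the bold fork if it is obtained from the disjoint union of $G'$ and $F$ by joining each of the three half-edges to a distinct vertex of degree 2 of $G'$. $K$ is obtained from $K'$ by $F$-addition if $G^K$ is obtained from $G^{K'}$ by addition of the bold fork; $F_K$ is the set of hexagons of $K$ corresponding to the vertices of $F$ and $V(F_K)$ the set of their vertices. $F$-no-edges are the derived white edges of $K$ with at least one endpoint in $V(F_K)$. -}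

module Defs where

open import Data.Bool.Base using (Bool)
open import Data.Fin.Base using (Fin; toℕ)
open import Data.Fin.Patterns using (0F; 1F; 2F; 3F; 4F; 5F)
open import Data.Fin.Subset using (Subset; _∈_)
open import Data.Nat.Base using (ℕ; _+_)
open import Data.Nat.DivMod using (_mod_)
open import Data.Product using (Σ; ∃; ∃!; _×_; _,_; proj₁; proj₂)
import Data.Product.Base as Product
open import Data.Sum.Base using (_⊎_; inj₁; inj₂)
open import Data.Sum.Relation.Binary.Pointwise using (_⊎ₛ_; inj₁; inj₂)
open import Function.Base using (_∘_)
open import Function.Bundles using (_↔_; module Inverse)
open import Function.Definitions using (Injective)
import Function.Bundles as Fun
open import Level using (0ℓ)
open import Relation.Binary.Bundles using (Setoid)
open import Relation.Binary.Construct.Closure.ReflexiveTransitive using (Star)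
open import Relation.Binary.PropositionalEquality
  using (_≡_; _≢_; refl; sym; trans; cong; setoid)
open import Relation.Nullary.Negation using (¬_)
open import Relation.Unary using (Pred)

------------------------------------------------------------------------
-- Unordered pairs

infix 4 _≐_

_≐_ : {V : Set} → V × V → V × V → Set
(u , v) ≐ (s , t) = (u ≡ s × v ≡ t) ⊎ (u ≡ t × v ≡ s)

_isEndOf_ : {V : Set} → V → V × V → Set
v isEndOf (s , t) = v ≡ s ⊎ v ≡ t

mapEnds : {V W : Set} → (V → W) → V × V → W × W
mapEnds f = Product.map f f

≐-refl : {V : Set} {p : V × V} → p ≐ p
≐-refl = inj₁ (refl , refl)

≐-sym : {V : Set} {p q : V × V} → p ≐ q → q ≐ p
≐-sym (inj₁ (refl , refl)) = inj₁ (refl , refl)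
≐-sym (inj₂ (refl , refl)) = inj₂ (refl , refl)

≐-trans : {V : Set} {p q r : V × V} → p ≐ q → q ≐ r → p ≐ r
≐-trans (inj₁ (refl , refl)) q≐r                  = q≐r
≐-trans (inj₂ (refl , refl)) (inj₁ (refl , refl)) = inj₂ (refl , refl)
≐-trans (inj₂ (refl , refl)) (inj₂ (refl , refl)) = inj₁ (refl , refl)

≐-map : {V W : Set} (f : V → W) {p q : V × V} →
        p ≐ q → mapEnds f p ≐ mapEnds f q
≐-map f (inj₁ (refl , refl)) = inj₁ (refl , refl)
≐-map f (inj₂ (refl , refl)) = inj₂ (refl , refl)

------------------------------------------------------------------------
-- Loopless multigraphs

-- Edges form a setoid because an edge of G^K is an unordered pair {e , ē}
-- of white edges, represented by either of its two members.
record Multigraph : Set₁ where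
  field
    Vertex : Set
    Edge   : Setoid 0ℓ 0ℓ

  open Setoid Edge public using (_≈_) renaming (Carrier to EdgeName)

  field
    ends      : EdgeName → Vertex × Vertex
    ends-cong : ∀ {e f} → e ≈ f → ends e ≐ ends f
    loopless  : ∀ e → proj₁ (ends e) ≢ proj₂ (ends e)

  Adjacent : Vertex → Vertex → Set
  Adjacent u v = ∃ λ e → ends e ≐ (u , v)

  Connected : Set
  Connected = ∀ u v → Star Adjacent u v

  ConnectedWithout : Vertex → Set
  ConnectedWithout d = ∀ u v → u ≢ d → v ≢ d →
    Star (λ s t → s ≢ d × t ≢ d × Adjacent s t) u v

  AtLeastThreeVertices : Set
  AtLeastThreeVertices =
    ∃ λ (u : Vertex) → ∃ λ (v : Vertex) → ∃ λ (w : Vertex) → u ≢ v × u ≢ w × v ≢ w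

  TwoConnected : Set
  TwoConnected =
    AtLeastThreeVertices × Connected × (∀ d → ConnectedWithout d)

  NoCycleOfLength2 : Set
  NoCycleOfLength2 = ∀ (e f : EdgeName) → ends e ≐ ends f → e ≈ f

  HasDegree2 : Vertex → Set
  HasDegree2 v = ∃ λ e → ∃ λ f →
    v isEndOf ends e × v isEndOf ends f × ¬ (e ≈ f) ×
    (∀ g → v isEndOf ends g → (g ≈ e) ⊎ (g ≈ f))

record _≅_ (G H : Multigraph) : Set where
  private
    module G = Multigraph G
    module H = Multigraph H
  field
    vertices : G.Vertex ↔ H.Vertex
    edges    : Fun.Inverse G.Edge H.Edge
    incident : ∀ e → H.ends (Inverse.to edges e)
                     ≐ mapEnds (Inverse.to vertices) (G.ends e)

------------------------------------------------------------------------
-- The bold fork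

data ForkVertex : Set where
  fx fy fz fa fb : ForkVertex

data ForkEdge : Set where
  zx zy za ab : ForkEdge

forkEnds : ForkEdge → ForkVertex × ForkVertex
forkEnds zx = fz , fx
forkEnds zy = fz , fy
forkEnds za = fz , fa
forkEnds ab = fa , fb

data HalfEdge : Set where
  hx hy hb : HalfEdge

foot : HalfEdge → ForkVertex
foot hx = fx
foot hy = fy
foot hb = fb

addFork : (G : Multigraph) → (HalfEdge → Multigraph.Vertex G) → Multigraph
addFork G attach = record
  { Vertex    = G.Vertex ⊎ ForkVertex
  ; Edge      = G.Edge ⊎ₛ setoid (ForkEdge ⊎ HalfEdge)
  ; ends      = ends′
  ; ends-cong = ends′-cong
  ; loopless  = loopless′
  }
  where
  module G = Multigraph G

  ends′ : G.EdgeName ⊎ (ForkEdge ⊎ HalfEdge) →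
          (G.Vertex ⊎ ForkVertex) × (G.Vertex ⊎ ForkVertex)
  ends′ (inj₁ e)        = mapEnds inj₁ (G.ends e)
  ends′ (inj₂ (inj₁ f)) = mapEnds inj₂ (forkEnds f)
  ends′ (inj₂ (inj₂ h)) = inj₂ (foot h) , inj₁ (attach h)

  ends′-cong : ∀ {e f} →
    Setoid._≈_ (G.Edge ⊎ₛ setoid (ForkEdge ⊎ HalfEdge)) e f →
    ends′ e ≐ ends′ f
  ends′-cong (inj₁ e≈f)  = ≐-map inj₁ (G.ends-cong e≈f)
  ends′-cong (inj₂ refl) = ≐-refl

  inj₁-inj : {s t : G.Vertex} → _≡_ {A = G.Vertex ⊎ ForkVertex} (inj₁ s) (inj₁ t) → s ≡ t
  inj₁-inj refl = refl

  loopless′ : ∀ e → proj₁ (ends′ e) ≢ proj₂ (ends′ e)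
  loopless′ (inj₁ e)         eq = G.loopless e (inj₁-inj eq)
  loopless′ (inj₂ (inj₁ zx)) ()
  loopless′ (inj₂ (inj₁ zy)) ()
  loopless′ (inj₂ (inj₁ za)) ()
  loopless′ (inj₂ (inj₁ ab)) ()
  loopless′ (inj₂ (inj₂ h))  ()

record ForkAddition (G G′ : Multigraph) : Set where
  field
    attach          : HalfEdge → Multigraph.Vertex G′
    attach-distinct : Injective _≡_ _≡_ attach
    attach-degree2  : ∀ h → Multigraph.HasDegree2 G′ (attach h)
    iso             : addFork G′ attach ≅ G

------------------------------------------------------------------------
-- Pseudohexes

data Colour : Set where
  blue red white : Colour

next opposite : Fin 6 → Fin 6
next     i = (toℕ i + 1) mod 6
opposite i = (toℕ i + 3) mod 6

opposite-involutive : ∀ i → opposite (opposite i) ≡ i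
opposite-involutive 0F = refl
opposite-involutive 1F = refl
opposite-involutive 2F = refl
opposite-involutive 3F = refl
opposite-involutive 4F = refl
opposite-involutive 5F = refl

-- The empty graph is included: all conditions hold vacuously for it.
record Pseudohex : Set where
  field
    order size : ℕ

  Vertex : Set
  Vertex = Fin order

  Edge : Set
  Edge = Fin size

  field
    ends      : Edge → Vertex × Vertex
    colour    : Edge → Colour
    side      : Vertex → Bool
    bipartite : ∀ e → side (proj₁ (ends e)) ≢ side (proj₂ (ends e))

    -- The blue edges form vertex-disjoint 6-cycles covering all vertices:
    -- corner (h , i) is the vertex vᵢ of the hexagon h, and the blue edges
    -- are exactly one edge from vᵢ to vᵢ₊₁ for each h and i.
    hexagons       : ℕ
    corner         : (Fin hexagons × Fin 6) ↔ Vertex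
    blueEdge       : Fin hexagons × Fin 6 → Edge
    blueEdge-blue  : ∀ c → colour (blueEdge c) ≡ blue
    blueEdge-ends  : ∀ h i → ends (blueEdge (h , i))
                     ≐ (Inverse.to corner (h , i) , Inverse.to corner (h , next i))
    blue⇒blueEdge  : ∀ e → colour e ≡ blue → ∃ λ c → e ≡ blueEdge c

  Hexagon : Set
  Hexagon = Fin hexagons

  hexagonOf : Vertex → Hexagon
  hexagonOf v = proj₁ (Inverse.from corner v)

  bar : Vertex → Vertex
  bar v = Inverse.to corner (Product.map₂ opposite (Inverse.from corner v))

  field
    red-diagonal   : ∀ v → ∃ λ r → colour r ≡ red × ends r ≐ (v , bar v)
    white-matching : ∀ v → ∃! _≡_ λ w → colour w ≡ white × v isEndOf ends w

  from-bar : ∀ v → Inverse.from corner (bar v)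
                   ≡ Product.map₂ opposite (Inverse.from corner v)
  from-bar v = Inverse.strictlyInverseʳ corner _

  bar-involutive : ∀ v → bar (bar v) ≡ v
  bar-involutive v =
    trans (cong (Inverse.to corner ∘ Product.map₂ opposite) (from-bar v))
    (trans (cong (λ i → Inverse.to corner (hexagonOf v , i))
                 (opposite-involutive _))
           (Inverse.strictlyInverseˡ corner v))

  hexagonOf-bar : ∀ v → hexagonOf (bar v) ≡ hexagonOf v
  hexagonOf-bar v = cong proj₁ (from-bar v)

  Barred : Edge → Edge → Set
  Barred e f = ends f ≐ mapEnds bar (ends e)

  ShareVertex : Edge → Edge → Set
  ShareVertex e f = ∃ λ v → v isEndOf ends e × v isEndOf ends f

  -- Only the ends of red edges matter: red edges parallel to {x , x̄} or
  -- {y , ȳ} do not prevent a white edge {x , y} from being real.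
  record Real (e : Edge) : Set where
    field
      is-white   : colour e ≡ white
      mate       : Edge
      mate-white : colour mate ≡ white
      mate-bar   : Barred e mate
      only-reds  : ∀ r → colour r ≡ red →
                   ShareVertex r e ⊎ ShareVertex r mate →
                   let (x , y) = ends e in
                   ends r ≐ (x , bar x) ⊎ ends r ≐ (y , bar y)

  Derived : Edge → Set
  Derived e = colour e ≡ white × ¬ Real e

  NoEnd : Set
  NoEnd = ∀ r w → colour r ≡ red → colour w ≡ white → ¬ (ends r ≐ ends w)

  -- Names of edges of G^K: real white edges between distinct hexagons.
  Link : Set
  Link = Σ Edge λ e → Real e ×
    hexagonOf (proj₁ (ends e)) ≢ hexagonOf (proj₂ (ends e))

  SameLink : Link → Link → Set
  SameLink (e , _) (f , _) = e ≡ f ⊎ Barred e f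

  parallel-white : ∀ {e f} → colour e ≡ white → colour f ≡ white →
                   ends e ≐ ends f → e ≡ f
  parallel-white {e} {f} we wf p = trans (sym (unique (we , inj₁ refl)))
                                         (unique (wf , end p))
    where
    unique : ∀ {w} → colour w ≡ white × proj₁ (ends e) isEndOf ends w →
             proj₁ (white-matching (proj₁ (ends e))) ≡ w
    unique = proj₂ (proj₂ (white-matching (proj₁ (ends e))))
    end : ends e ≐ ends f → proj₁ (ends e) isEndOf ends f
    end (inj₁ (eq , _)) = inj₁ eq
    end (inj₂ (eq , _)) = inj₂ eq

  bar-bar : (p : Vertex × Vertex) → mapEnds bar (mapEnds bar p) ≐ p
  bar-bar (u , v) = inj₁ (bar-involutive u , bar-involutive v)

  Barred-sym : ∀ {e f} → Barred e f → Barred f e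
  Barred-sym {e} b = ≐-sym (≐-trans (≐-map bar b) (bar-bar (ends e)))

  SameLink-sym : ∀ {k l} → SameLink k l → SameLink l k
  SameLink-sym (inj₁ eq)            = inj₁ (sym eq)
  SameLink-sym {e , _} {f , _} (inj₂ b) = inj₂ (Barred-sym {e} {f} b)

  SameLink-trans : ∀ {k l m} → SameLink k l → SameLink l m → SameLink k m
  SameLink-trans (inj₁ refl) l∼m         = l∼m
  SameLink-trans (inj₂ b)    (inj₁ refl) = inj₂ b
  SameLink-trans {e , re , _} {_} {g , rg , _} (inj₂ b) (inj₂ c) =
    inj₁ (parallel-white (Real.is-white re) (Real.is-white rg)
      (≐-sym (≐-trans c (≐-trans (≐-map bar b) (bar-bar (ends e))))))

  linkEnds : Link → Hexagon × Hexagon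
  linkEnds (e , _) = mapEnds hexagonOf (ends e)

  linkEnds-cong : ∀ {k l} → SameLink k l → linkEnds k ≐ linkEnds l
  linkEnds-cong (inj₁ refl) = ≐-refl
  linkEnds-cong {e , _} (inj₂ b) = ≐-sym (≐-trans (≐-map hexagonOf b)
    (inj₁ (hexagonOf-bar _ , hexagonOf-bar _)))

  hexagonGraph : Multigraph
  hexagonGraph = record
    { Vertex    = Hexagon
    ; Edge      = record
      { Carrier       = Link
      ; _≈_           = SameLink
      ; isEquivalence = record
        { refl  = inj₁ refl
        ; sym   = λ {k} {l} → SameLink-sym {k} {l}
        ; trans = λ {k} {l} {m} → SameLink-trans {k} {l} {m}
        }
      }
    ; ends      = linkEnds
    ; ends-cong = λ {k} {l} → linkEnds-cong {k} {l}
    ; loopless  = λ (_ , _ , distinct) → distinct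
    }

  Proper : Set
  Proper = NoEnd × Multigraph.TwoConnected hexagonGraph
                 × Multigraph.NoCycleOfLength2 hexagonGraph

  PerfectMatchingOf : Hexagon → Subset size → Set
  PerfectMatchingOf h N =
    (∀ e → e ∈ N → ∃ λ i → e ≡ blueEdge (h , i)) ×
    (∀ v → hexagonOf v ≡ h → ∃! _≡_ λ e → e ∈ N × v isEndOf ends e)

  -- The contracted paths of the reduction of the hexagons in S by the
  -- matchings N h (h in S) are the components of the subgraph with edge set
  -- Contracted S N; these, and hence safety, are determined by K itself,
  -- without the graph resulting from the reduction.
  module _ (S : Pred Hexagon 0ℓ) (N : Hexagon → Subset size) where

    data Contracted (e : Edge) : Set where
      blueᶜ  : ∀ h → S h → e ∈ N h → Contracted e
      whiteᶜ : colour e ≡ white →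
               (∃ λ v → v isEndOf ends e × S (hexagonOf v)) → Contracted e

    SameContractedPath : Edge → Edge → Set
    SameContractedPath e f =
      Star (λ u v → ∃ λ g → Contracted g × ends g ≐ (u , v))
           (proj₁ (ends e)) (proj₁ (ends f))

    SafeReduction : Set
    SafeReduction = ∀ e f → Contracted e → Contracted f →
      Derived e → Derived f → SameContractedPath e f → e ≡ f

  CanBeSafelyReduced : Pred Hexagon 0ℓ → Set
  CanBeSafelyReduced S = ∃ λ (N : Hexagon → Subset size) →
    (∀ h → S h → PerfectMatchingOf h (N h)) × SafeReduction S N

FAddition : Pseudohex → Pseudohex → Set
FAddition K K′ =
  ForkAddition (Pseudohex.hexagonGraph K) (Pseudohex.hexagonGraph K′)

module _ (K K′ : Pseudohex) (A : FAddition K K′) where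
  open Pseudohex K
  open ForkAddition A

  F-hexagons : Pred Hexagon 0ℓ
  F-hexagons h = ∃ λ (f : ForkVertex) →
    Inverse.to (_≅_.vertices iso) (inj₂ f) ≡ h

  F-vertices : Pred Vertex 0ℓ
  F-vertices v = F-hexagons (hexagonOf v)

  F-no-edge : Pred Edge 0ℓ
  F-no-edge e = Derived e × ∃ λ v → v isEndOf ends e × F-vertices v

{-# OPTIONS --safe #-}
-- Call the three antipodal pairs of a hexagon its ports. A perfect matching of
-- the hexagon joins the true-side vertex of each port to the false-side vertex
-- of the next one in one of the two cyclic orders of the ports, so choosing
-- matchings amounts to choosing a planar embedding of the fork, and the
-- contracted paths trace its faces. In K the seven leaves of the fork are its
-- three half-edges and one loose port at each of x, y, a, b; the white edges at
-- the loose ports are exactly the F-no-edges, and they match the loose ports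
-- among themselves without fixed points. If the white edge at the false-side
-- vertex of the loose port of x leads to the loose port of g, the embedding is
-- chosen so that no two loose ports are consecutive except g followed by x.
-- Following the derived edges from face to face then yields paths and cycles
-- with at most one derived edge each.
module Submission where

open import Defs
open import Data.Bool.Base using (Bool; true; false; not)
open import Data.Bool.Properties using (¬-not; not-¬; not-injective; not-involutive)
  renaming (_≟_ to _≟ᵇ_)
open import Data.Fin.Base using (Fin)
open import Data.Fin.Patterns using (0F; 1F; 2F; 3F; 4F; 5F)
open import Data.Fin.Properties using (_≟_; any?)
open import Data.Fin.Subset using (Subset; _∈_)
open import Data.Product using (∃; ∃!; _×_; _,_; proj₁; proj₂)
open import Data.Sum.Base using (_⊎_; inj₁; inj₂; swap; [_,_]′)
open import Data.Unit.Base using (⊤; tt)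
open import Data.Vec.Base using (tabulate)
open import Data.Vec.Properties using (lookup∘tabulate; []=⇒lookup; lookup⇒[]=)
open import Function.Base using (_∘_; case_of_)
open import Function.Bundles using (module Inverse)
open import Relation.Binary.Construct.Closure.ReflexiveTransitive using (Star; ε; _◅_)
open import Relation.Binary.PropositionalEquality
open import Relation.Nullary.Decidable using (Dec; yes; no; does; dec-true; _×-dec_)
open import Relation.Nullary.Negation using (¬_; contradiction)

-- Unordered pairs and their ends

≐-flip : {V : Set} {p : V × V} {u v : V} → p ≐ (u , v) → p ≐ (v , u)
≐-flip p≐ = ≐-trans p≐ (inj₂ (refl , refl))

≐-cancelˡ : {V : Set} {u v w : V} → (u , v) ≐ (u , w) → v ≡ w
≐-cancelˡ (inj₁ (_ , v≡w))   = v≡w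
≐-cancelˡ (inj₂ (u≡w , v≡u)) = trans v≡u u≡w

≐⇒isEndOf : {V : Set} {p : V × V} {u v : V} → p ≐ (u , v) → u isEndOf p
≐⇒isEndOf (inj₁ (eq , _)) = inj₁ (sym eq)
≐⇒isEndOf (inj₂ (_ , eq)) = inj₂ (sym eq)

isEndOf-resp : {V : Set} {p q : V × V} {u : V} → p ≐ q → u isEndOf p → u isEndOf q
isEndOf-resp (inj₁ (refl , refl)) u∈p = u∈p
isEndOf-resp (inj₂ (refl , refl)) u∈p = swap u∈p

isEndOf-map : {V W : Set} (f : V → W) {p : V × V} {u : V} →
              u isEndOf p → f u isEndOf mapEnds f p
isEndOf-map f (inj₁ refl) = inj₁ refl
isEndOf-map f (inj₂ refl) = inj₂ refl

does-true : {P : Set} (P? : Dec P) → does P? ≡ true → P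
does-true (yes p) _ = p

-- Rotations of Fin 3

row : {P : Fin 3 → Set} → P 0F → P 1F → P 2F → ∀ i → P i
row p q r 0F = p
row p q r 1F = q
row p q r 2F = r

rot : Bool → Fin 3 → Fin 3
rot true  0F = 1F
rot true  1F = 2F
rot true  2F = 0F
rot false 0F = 2F
rot false 1F = 0F
rot false 2F = 1F

rot-not-rot : ∀ s i → rot (not s) (rot s i) ≡ i
rot-not-rot true  0F = refl
rot-not-rot true  1F = refl
rot-not-rot true  2F = refl
rot-not-rot false 0F = refl
rot-not-rot false 1F = refl
rot-not-rot false 2F = refl

≢⇒rot : ∀ {i j} → i ≢ j → ∃ λ s → rot s i ≡ j
≢⇒rot {0F} {0F} i≢j = contradiction refl i≢j
≢⇒rot {0F} {1F} i≢j = true , refl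
≢⇒rot {0F} {2F} i≢j = false , refl
≢⇒rot {1F} {0F} i≢j = false , refl
≢⇒rot {1F} {1F} i≢j = contradiction refl i≢j
≢⇒rot {1F} {2F} i≢j = true , refl
≢⇒rot {2F} {0F} i≢j = true , refl
≢⇒rot {2F} {1F} i≢j = false , refl
≢⇒rot {2F} {2F} i≢j = contradiction refl i≢j

rot-third : ∀ s i {j} → i ≢ j → rot s i ≢ j → rot s (rot s i) ≡ j
rot-third true  0F {0F} p q = contradiction refl p
rot-third true  0F {1F} p q = contradiction refl q
rot-third true  0F {2F} p q = refl
rot-third true  1F {0F} p q = refl
rot-third true  1F {1F} p q = contradiction refl p
rot-third true  1F {2F} p q = contradiction refl q
rot-third true  2F {0F} p q = contradiction refl q
rot-third true  2F {1F} p q = refl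
rot-third true  2F {2F} p q = contradiction refl p
rot-third false 0F {0F} p q = contradiction refl p
rot-third false 0F {1F} p q = refl
rot-third false 0F {2F} p q = contradiction refl q
rot-third false 1F {0F} p q = contradiction refl q
rot-third false 1F {1F} p q = contradiction refl p
rot-third false 1F {2F} p q = refl
rot-third false 2F {0F} p q = refl
rot-third false 2F {1F} p q = contradiction refl q
rot-third false 2F {2F} p q = contradiction refl p

-- The six permutations of `Fin 3`, each given by the image of `0F` and by whether it keeps or
-- reverses the cyclic order.
spin : Bool → Fin 3 → Fin 3 → Fin 3
spin s a 0F = a
spin s a 1F = rot s a
spin s a 2F = rot s (rot s a)

rot-cube : ∀ s a → rot s (rot s (rot s a)) ≡ a
rot-cube true  0F = refl
rot-cube true  1F = refl
rot-cube true  2F = refl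
rot-cube false 0F = refl
rot-cube false 1F = refl
rot-cube false 2F = refl

infixr 8 _⊙_

_⊙_ : Bool → Bool → Bool
true  ⊙ s = s
false ⊙ s = not s

-- Modulo 3, `spin s a i` is a + i or a - i, so stepping `i` in sense `o` steps the value in the
-- product of the two senses.
spin-rot : ∀ o s a i → rot (o ⊙ s) (spin s a i) ≡ spin s a (rot o i)
spin-rot true  s a 0F = refl
spin-rot true  s a 1F = refl
spin-rot true  s a 2F = rot-cube s a
spin-rot false s a 0F =
  trans (cong (rot (not s)) (sym (rot-cube s a))) (rot-not-rot s _)
spin-rot false s a 1F = rot-not-rot s _
spin-rot false s a 2F = rot-not-rot s _

spin-onto : ∀ s a j → ∃ λ i → spin s a i ≡ j
spin-onto s a j with a ≟ j | rot s a ≟ j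
... | yes a≡j | _       = 0F , a≡j
... | no _    | yes p   = 1F , p
... | no a≢j  | no p    = 2F , rot-third s a a≢j p

rot-≢ : ∀ s i → rot s i ≢ i
rot-≢ true  0F ()
rot-≢ true  1F ()
rot-≢ true  2F ()
rot-≢ false 0F ()
rot-≢ false 1F ()
rot-≢ false 2F ()

spin-injective : ∀ s a i j → spin s a i ≡ spin s a j → i ≡ j
spin-injective s a i j eq with i ≟ j
... | yes i≡j = i≡j
... | no  i≢j with o , refl ← ≢⇒rot i≢j =
  contradiction (trans (spin-rot o s a i) (sym eq)) (rot-≢ (o ⊙ s) _)

-- Positions around a hexagon

-- Indexed so that, when `b` is the side of corner `0F`, exactly the true-side corners occur;
-- opposite corners have the other parity.
position : Bool → Fin 3 → Fin 6
position true  0F = 0F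
position true  1F = 2F
position true  2F = 4F
position false 0F = 1F
position false 1F = 3F
position false 2F = 5F

position-cover : ∀ b i → ∃ λ j → i ≡ position b j ⊎ i ≡ opposite (position b j)
position-cover true  0F = 0F , inj₁ refl
position-cover true  1F = 2F , inj₂ refl
position-cover true  2F = 1F , inj₁ refl
position-cover true  3F = 0F , inj₂ refl
position-cover true  4F = 2F , inj₁ refl
position-cover true  5F = 1F , inj₂ refl
position-cover false 0F = 1F , inj₂ refl
position-cover false 1F = 0F , inj₁ refl
position-cover false 2F = 2F , inj₂ refl
position-cover false 3F = 1F , inj₁ refl
position-cover false 4F = 0F , inj₂ refl
position-cover false 5F = 2F , inj₁ refl

half : Fin 6 → Fin 3
half 0F = 0F
half 1F = 0F
half 2F = 1F
half 3F = 1F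
half 4F = 2F
half 5F = 2F

half-position : ∀ b j → half (position b j) ≡ j
half-position true  0F = refl
half-position true  1F = refl
half-position true  2F = refl
half-position false 0F = refl
half-position false 1F = refl
half-position false 2F = refl

-- Positions are 2j or 2j + 1, and one step forward is two steps back followed by three across: 1 =
-- -2 + 3.
next-position : ∀ b j → next (position b j) ≡ opposite (position b (rot false j))
next-position true  0F = refl
next-position true  1F = refl
next-position true  2F = refl
next-position false 0F = refl
next-position false 1F = refl
next-position false 2F = refl

next-opposite-position : ∀ b j →
  next (opposite (position b j)) ≡ position b (rot false j)
next-opposite-position true  0F = refl
next-opposite-position true  1F = refl
next-opposite-position true  2F = refl
next-opposite-position false 0F = refl
next-opposite-position false 1F = refl
next-opposite-position false 2F = refl

prev : Fin 6 → Fin 6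
prev 0F = 5F
prev 1F = 0F
prev 2F = 1F
prev 3F = 2F
prev 4F = 3F
prev 5F = 4F

next-prev : ∀ i → next (prev i) ≡ i
next-prev 0F = refl
next-prev 1F = refl
next-prev 2F = refl
next-prev 3F = refl
next-prev 4F = refl
next-prev 5F = refl

prev-next : ∀ i → prev (next i) ≡ i
prev-next 0F = refl
prev-next 1F = refl
prev-next 2F = refl
prev-next 3F = refl
prev-next 4F = refl
prev-next 5F = refl

module PseudohexProperties (K : Pseudohex) where
  open Pseudohex K

  -- The white matching as an involution

  edge-sides : ∀ {e u v} → ends e ≐ (u , v) → side v ≡ not (side u)
  edge-sides {e} (inj₁ (refl , refl)) = ¬-not (bipartite e ∘ sym)
  edge-sides {e} (inj₂ (refl , refl)) = ¬-not (bipartite e)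

  whiteAt : Vertex → Edge
  whiteAt v = proj₁ (white-matching v)

  whiteAt-white : ∀ v → colour (whiteAt v) ≡ white
  whiteAt-white v = proj₁ (proj₁ (proj₂ (white-matching v)))

  private
    otherEnd : ∀ {v : Vertex} p → v isEndOf p → ∃ λ w → p ≐ (v , w)
    otherEnd (s , t) (inj₁ refl) = t , ≐-refl
    otherEnd (s , t) (inj₂ refl) = s , inj₂ (refl , refl)

    whiteAt-other : ∀ v → ∃ λ w → ends (whiteAt v) ≐ (v , w)
    whiteAt-other v = otherEnd _ (proj₂ (proj₁ (proj₂ (white-matching v))))

  ω : Vertex → Vertex
  ω v = proj₁ (whiteAt-other v)

  whiteAt-ends : ∀ v → ends (whiteAt v) ≐ (v , ω v)
  whiteAt-ends v = proj₂ (whiteAt-other v)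

  whiteAt-unique : ∀ {e u} → colour e ≡ white → u isEndOf ends e → whiteAt u ≡ e
  whiteAt-unique we u∈e = proj₂ (proj₂ (white-matching _)) (we , u∈e)

  white-ends : ∀ {e v} → colour e ≡ white → v isEndOf ends e → ends e ≐ (v , ω v)
  white-ends {v = v} we v∈ with refl ← whiteAt-unique we v∈ = whiteAt-ends v

  ω-unique : ∀ {e u v} → colour e ≡ white → ends e ≐ (u , v) → ω u ≡ v
  ω-unique we p = ≐-cancelˡ (≐-trans (≐-sym (white-ends we (≐⇒isEndOf p))) p)

  ω-involutive : ∀ v → ω (ω v) ≡ v
  ω-involutive v = ω-unique (whiteAt-white v) (≐-flip (whiteAt-ends v))

  side-ω : ∀ v → side (ω v) ≡ not (side v)
  side-ω v = edge-sides (whiteAt-ends v)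

  side-bar : ∀ v → side (bar v) ≡ not (side v)
  side-bar v = edge-sides (proj₂ (proj₂ (red-diagonal v)))

  -- An equality would make the white edge at `v` parallel to the red diagonal, hence an end.
  ω≢bar : NoEnd → ∀ v → ω v ≢ bar v
  ω≢bar noEnd v eq with r , red-r , r-ends ← red-diagonal v =
    noEnd r (whiteAt v) red-r (whiteAt-white v)
      (≐-trans r-ends (≐-sym (subst (λ w → ends (whiteAt v) ≐ (v , w)) eq (whiteAt-ends v))))

  -- The vertices of a hexagon

  open Inverse corner using (to; from; strictlyInverseˡ; strictlyInverseʳ)

  side-next : ∀ h i → side (to (h , next i)) ≡ not (side (to (h , i)))
  side-next h i = edge-sides (blueEdge-ends h i)

  side-0F : Hexagon → Bool
  side-0F h = side (to (h , 0F))

  -- Corner numbering may start on either side; `side-0F h` corrects for this, so that `T h` always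
  -- lists the true side.
  T : Hexagon → Fin 3 → Vertex
  T h j = to (h , position (side-0F h) j)

  hexagonOf-T : ∀ h j → hexagonOf (T h j) ≡ h
  hexagonOf-T h j = cong proj₁ (strictlyInverseʳ _)

  bar-to : ∀ h i → bar (to (h , i)) ≡ to (h , opposite i)
  bar-to h i = cong (λ c → to (proj₁ c , opposite (proj₂ c))) (strictlyInverseʳ (h , i))

  side-T : ∀ h j → side (T h j) ≡ true
  side-T h j = go (side-0F h) refl j
    where
    two : ∀ {i} → side (to (h , i)) ≡ true → side (to (h , next (next i))) ≡ true
    two p = trans (side-next h _) (cong not (trans (side-next h _) (cong not p)))

    first : side (to (h , 0F)) ≡ false → side (to (h , 1F)) ≡ true
    first eq = trans (side-next h 0F) (cong not eq)

    go : ∀ b → side (to (h , 0F)) ≡ b → ∀ j → side (to (h , position b j)) ≡ true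
    go true  eq 0F = eq
    go true  eq 1F = two eq
    go true  eq 2F = two (two eq)
    go false eq 0F = first eq
    go false eq 1F = two (first eq)
    go false eq 2F = two (two (first eq))

  to-injective : ∀ {c d} → to c ≡ to d → c ≡ d
  to-injective eq = trans (sym (strictlyInverseʳ _)) (trans (cong from eq) (strictlyInverseʳ _))

  T-injective : ∀ h {i j} → T h i ≡ T h j → i ≡ j
  T-injective h eq = trans (sym (half-position _ _))
    (trans (cong (half ∘ proj₂) (to-injective eq)) (half-position _ _))

  T-cover : ∀ v → ∃ λ j → v ≡ T (hexagonOf v) j ⊎ v ≡ bar (T (hexagonOf v) j)
  T-cover v with position-cover (side-0F (hexagonOf v)) (proj₂ (from v))
  ... | j , inj₁ p = j , inj₁ (trans (sym (strictlyInverseˡ v)) (cong (λ i → to (_ , i)) p))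
  ... | j , inj₂ p = j , inj₂ (trans (sym (strictlyInverseˡ v))
    (trans (cong (λ i → to (_ , i)) p) (sym (bar-to _ _))))

  -- The two perfect matchings of a hexagon

  StartsAt : Hexagon → Bool → Edge → Set
  StartsAt h b e = ∃ λ i → e ≡ blueEdge (h , i) × side (to (h , i)) ≡ b

  startsAt? : ∀ h b e → Dec (StartsAt h b e)
  startsAt? h b e = any? λ i → (e ≟ blueEdge (h , i)) ×-dec (side (to (h , i)) ≟ᵇ b)

  -- Sides alternate along the 6-cycle, so the edges whose first corner has side `b` are every
  -- second one.
  matching : Hexagon → Bool → Subset size
  matching h b = tabulate (does ∘ startsAt? h b)

  ∈matching⁻ : ∀ {h b e} → e ∈ matching h b → StartsAt h b e
  ∈matching⁻ {h} {b} {e} e∈ = does-true (startsAt? h b e)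
    (trans (sym (lookup∘tabulate _ e)) ([]=⇒lookup e∈))

  ∈matching⁺ : ∀ {h b e} → StartsAt h b e → e ∈ matching h b
  ∈matching⁺ {h} {b} {e} p = lookup⇒[]= e _
    (trans (lookup∘tabulate _ e) (dec-true (startsAt? h b e) p))

  -- A vertex of side `b` is covered by the edge starting there, any other by the edge starting at
  -- its predecessor.
  matching-perfect : ∀ h b → PerfectMatchingOf h (matching h b)
  matching-perfect h b =
    (λ e e∈ → let i , eq , _ = ∈matching⁻ e∈ in i , eq) ,
    λ v v∈h → subst Matched
      (trans (cong (λ k → to (k , proj₂ (from v))) (sym v∈h)) (strictlyInverseˡ v))
      (matched (proj₂ (from v)))
    where
    Matched : Vertex → Set
    Matched v = ∃! _≡_ λ e → e ∈ matching h b × v isEndOf ends e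

    starts : ∀ {i j} → side (to (h , i)) ≡ b → side (to (h , j)) ≡ b →
             to (h , i) isEndOf ends (blueEdge (h , j)) → i ≡ j
    starts si sj i∈ with isEndOf-resp (blueEdge-ends h _) i∈
    ... | inj₁ eq = cong proj₂ (to-injective eq)
    ... | inj₂ eq = contradiction
      (trans (sym si) (trans (cong side eq) (trans (side-next h _) (cong not sj)))) (not-¬ refl)

    finishes : ∀ {i j} → side (to (h , next i)) ≢ b → side (to (h , j)) ≡ b →
               to (h , next i) isEndOf ends (blueEdge (h , j)) → i ≡ j
    finishes si sj i∈ with isEndOf-resp (blueEdge-ends h _) i∈
    ... | inj₁ eq = contradiction (trans (cong side eq) sj) si
    ... | inj₂ eq = trans (sym (prev-next _))
      (trans (cong (prev ∘ proj₂) (to-injective eq)) (prev-next _))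

    matched : ∀ i → Matched (to (h , i))
    matched i with side (to (h , i)) ≟ᵇ b
    ... | yes si = blueEdge (h , i) ,
      (∈matching⁺ (i , refl , si) , ≐⇒isEndOf (blueEdge-ends h i)) ,
      λ { (e∈ , i∈) → case ∈matching⁻ e∈ of λ { (j , refl , sj) →
          cong (λ k → blueEdge (h , k)) (starts si sj i∈) } }
    ... | no ¬si = subst (λ k → Matched (to (h , k))) (next-prev i)
      (matched-next {prev i} (¬si ∘ subst (λ k → side (to (h , k)) ≡ b) (next-prev i)))
      where
      matched-next : ∀ {k} → side (to (h , next k)) ≢ b → Matched (to (h , next k))
      matched-next {k} ¬s = blueEdge (h , k) ,
        (∈matching⁺ (k , refl , not-injective (trans (sym (side-next h k)) (¬-not ¬s))) ,
         ≐⇒isEndOf (≐-flip (blueEdge-ends h k))) ,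
        λ { (e∈ , k∈) → case ∈matching⁻ e∈ of λ { (j , refl , sj) →
            cong (λ l → blueEdge (h , l)) (finishes ¬s sj k∈) } }

  -- Blue steps that start on the true side go from port `j` to `rot false j`; those that start on
  -- the false side do so too, but read from their true-side end they go the opposite way. Hence
  -- `not b`.
  matching-ends : ∀ {h b e} → e ∈ matching h b →
                  ∃ λ j → ends e ≐ (T h j , bar (T h (rot (not b) j)))
  matching-ends {h} {b} e∈ with ∈matching⁻ e∈
  ... | i , refl , si with position-cover (side-0F h) i
  ... | j , inj₁ refl with refl ← trans (sym si) (side-T h j) =
    j , ≐-trans (blueEdge-ends h i) (inj₁ (refl ,
      trans (cong (λ k → to (h , k)) (next-position (side-0F h) j)) (sym (bar-to h _))))
  ... | j , inj₂ refl
    with refl ← trans (sym si) (trans (cong side (sym (bar-to h _)))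
                                 (trans (side-bar _) (cong not (side-T h j)))) =
    rot false j , ≐-flip (≐-trans (blueEdge-ends h i) (inj₁
      ( trans (sym (bar-to h _)) (cong (bar ∘ T h) (sym (rot-not-rot false j)))
      , cong (λ k → to (h , k)) (next-opposite-position (side-0F h) j))))

  -- The vertices used by a link

  -- `Real` treats an edge and its mate alike, because a diagonal is the same when named from either
  -- of its ends.
  Real-mate : ∀ {e} (r : Real e) → Real (Real.mate r)
  Real-mate {e} r = record
    { is-white   = mate-white
    ; mate       = e
    ; mate-white = is-white
    ; mate-bar   = Barred-sym {e} {mate} mate-bar
    ; only-reds  = λ r red-r shares → barred mate-bar (only-reds r red-r (swap shares))
    }
    where
    open Real r

    diagonal : ∀ {p u v} → v ≡ bar u → p ≐ (u , bar u) → p ≐ (v , bar v)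
    diagonal refl p≐ = ≐-trans p≐ (inj₂ (sym (bar-involutive _) , refl))

    barred : ∀ {p q u v} → q ≐ (bar u , bar v) →
             p ≐ (u , bar u) ⊎ p ≐ (v , bar v) →
             p ≐ (proj₁ q , bar (proj₁ q)) ⊎ p ≐ (proj₂ q , bar (proj₂ q))
    barred (inj₁ (eq , _)) (inj₁ p≐) = inj₁ (diagonal eq p≐)
    barred (inj₁ (_ , eq)) (inj₂ p≐) = inj₂ (diagonal eq p≐)
    barred (inj₂ (_ , eq)) (inj₁ p≐) = inj₂ (diagonal eq p≐)
    barred (inj₂ (eq , _)) (inj₂ p≐) = inj₁ (diagonal eq p≐)

  -- A link stands for an edge with its mate; the second alternative says that `v` is an end of the
  -- mate.
  OnLink : Link → Vertex → Set
  OnLink (e , _) v = v isEndOf ends e ⊎ bar v isEndOf ends e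

  OnLink-bar : ∀ ℓ {v} → OnLink ℓ v → OnLink ℓ (bar v)
  OnLink-bar (e , _) (inj₁ v∈) = inj₂ (subst (_isEndOf ends e) (sym (bar-involutive _)) v∈)
  OnLink-bar _       (inj₂ v∈) = inj₁ v∈

  OnLink-resp : ∀ {k ℓ v} → SameLink k ℓ → v isEndOf ends (proj₁ k) → OnLink ℓ v
  OnLink-resp (inj₁ refl) v∈ = inj₁ v∈
  OnLink-resp (inj₂ b)    v∈ = inj₂ (isEndOf-resp (≐-sym b) (isEndOf-map bar v∈))

  OnLink-real : ∀ ℓ {v} → OnLink ℓ v → Real (whiteAt v)
  OnLink-real (e , r , _) (inj₁ v∈)
    with refl ← whiteAt-unique (Real.is-white r) v∈ = r
  OnLink-real (e , r , _) {v} (inj₂ v∈)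
    with refl ← whiteAt-unique (Real.mate-white r)
      (subst (_isEndOf ends (Real.mate r)) (bar-involutive v)
        (isEndOf-resp (≐-sym (Real.mate-bar r)) (isEndOf-map bar v∈))) = Real-mate r

  OnLink-ω-bar : ∀ ℓ {v} → OnLink ℓ v → ω (bar v) ≡ bar (ω v)
  OnLink-ω-bar ℓ {v} on = ω-unique mate-white
    (≐-trans mate-bar (≐-map bar (whiteAt-ends v)))
    where open Real (OnLink-real ℓ on)

  OnLink-ends : ∀ ℓ {v} → OnLink ℓ v → linkEnds ℓ ≐ (hexagonOf v , hexagonOf (ω v))
  OnLink-ends (e , r , _) (inj₁ v∈) = ≐-map hexagonOf (white-ends (Real.is-white r) v∈)
  OnLink-ends ℓ@(e , r , _) {v} (inj₂ v∈) = ≐-trans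
    (≐-map hexagonOf (white-ends (Real.is-white r) v∈))
    (inj₁ (hexagonOf-bar v , trans (cong hexagonOf (OnLink-ω-bar ℓ (inj₂ v∈))) (hexagonOf-bar _)))

  OnLink-far : ∀ ℓ {v p q} → OnLink ℓ v → linkEnds ℓ ≐ (p , q) → hexagonOf v ≡ p →
               hexagonOf (ω v) ≡ q
  OnLink-far ℓ on p≐ refl = ≐-cancelˡ (≐-trans (≐-sym (OnLink-ends ℓ on)) p≐)

  OnLink-ω : ∀ ℓ {v} → OnLink ℓ v → OnLink ℓ (ω v)
  OnLink-ω (e , r , _) (inj₁ v∈) = inj₁ (≐⇒isEndOf (≐-flip (white-ends (Real.is-white r) v∈)))
  OnLink-ω ℓ@(e , r , _) on@(inj₂ v∈) = inj₂ (subst (_isEndOf ends e) (OnLink-ω-bar ℓ on)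
    (≐⇒isEndOf (≐-flip (white-ends (Real.is-white r) v∈))))

  private
    end-unique : ∀ ((e , _) : Link) {u v} → u isEndOf ends e → v isEndOf ends e →
                 hexagonOf u ≡ hexagonOf v → u ≡ v
    end-unique _           (inj₁ refl) (inj₁ refl) _  = refl
    end-unique (_ , _ , d) (inj₁ refl) (inj₂ refl) eq = contradiction eq d
    end-unique (_ , _ , d) (inj₂ refl) (inj₁ refl) eq = contradiction (sym eq) d
    end-unique _           (inj₂ refl) (inj₂ refl) _  = refl

  -- The ends of the edge lie in different hexagons, so a link meets a hexagon in at most one
  -- antipodal pair: it occupies one port.
  OnLink-unique : ∀ ℓ {u v} → OnLink ℓ u → OnLink ℓ v → hexagonOf u ≡ hexagonOf v →
                  u ≡ v ⊎ u ≡ bar v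
  OnLink-unique ℓ (inj₁ u∈) (inj₁ v∈) eq = inj₁ (end-unique ℓ u∈ v∈ eq)
  OnLink-unique ℓ {u} {v} (inj₁ u∈) (inj₂ v∈) eq =
    inj₂ (end-unique ℓ u∈ v∈ (trans eq (sym (hexagonOf-bar v))))
  OnLink-unique ℓ {u} {v} (inj₂ u∈) (inj₁ v∈) eq = inj₂ (trans (sym (bar-involutive u))
    (cong bar (end-unique ℓ u∈ v∈ (trans (hexagonOf-bar u) eq))))
  OnLink-unique ℓ {u} {v} (inj₂ u∈) (inj₂ v∈) eq = inj₁
    (trans (sym (bar-involutive u)) (trans (cong bar (end-unique ℓ u∈ v∈
      (trans (hexagonOf-bar u) (trans eq (sym (hexagonOf-bar v)))))) (bar-involutive v)))

  OnLink-T : ∀ ℓ {h} → h isEndOf linkEnds ℓ → ∃ λ j → OnLink ℓ (T h j)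
  OnLink-T ℓ@(e , _) = [ (λ { refl → at (inj₁ refl) }) , (λ { refl → at (inj₂ refl) }) ]′
    where
    at : ∀ {v} → v isEndOf ends e → ∃ λ j → OnLink ℓ (T (hexagonOf v) j)
    at {v} v∈ with T-cover v
    ... | j , inj₁ eq = j , subst (OnLink ℓ) eq (inj₁ v∈)
    ... | j , inj₂ eq = j , subst (OnLink ℓ) (trans (cong bar eq) (bar-involutive _))
                              (OnLink-bar ℓ (inj₁ v∈))

  OnLink-loopless : ∀ ℓ {v} → OnLink ℓ v → hexagonOf v ≢ hexagonOf (ω v)
  OnLink-loopless ℓ@(_ , _ , d) on eq with OnLink-ends ℓ on
  ... | inj₁ (p , q) = d (trans p (trans eq (sym q)))
  ... | inj₂ (p , q) = d (trans p (trans (sym eq) (sym q)))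

  whiteAt-ω : ∀ v → whiteAt (ω v) ≡ whiteAt v
  whiteAt-ω v = whiteAt-unique (whiteAt-white v) (≐⇒isEndOf (≐-flip (whiteAt-ends v)))

-- The fork

-- Where a port leads: along a fork edge to a port of another fork vertex, along a half-edge out of
-- the fork, or along no link at all.
data Far : Set where
  glued : ForkEdge → ForkVertex → Fin 3 → Far
  outer : HalfEdge → Far
  loose : Far

-- Except at `fz`, port `0F` points towards `fz` and port `2F` is the loose one.
far : ForkVertex → Fin 3 → Far
far fz 0F = glued zx fx 0F
far fz 1F = glued zy fy 0F
far fz 2F = glued za fa 0F
far fx 0F = glued zx fz 0F
far fx 1F = outer hx
far fx 2F = loose
far fy 0F = glued zy fz 1F
far fy 1F = outer hy
far fy 2F = loose
far fa 0F = glued za fz 2F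
far fa 1F = glued ab fb 0F
far fa 2F = loose
far fb 0F = glued ab fa 1F
far fb 1F = outer hb
far fb 2F = loose

-- The facts about the table that later arguments use: gluing is symmetric, a half-edge sits at its
-- foot, and a vertex has at most one loose port.
Consistent : ForkVertex → Fin 3 → Far → Set
Consistent f i (glued e g j) = forkEnds e ≐ (f , g) × far g j ≡ glued e f i
Consistent f i (outer h)     = foot h ≡ f
Consistent f i loose         = i ≡ 2F

far-consistent : ∀ f i → Consistent f i (far f i)
far-consistent fz 0F = inj₁ (refl , refl) , refl
far-consistent fz 1F = inj₁ (refl , refl) , refl
far-consistent fz 2F = inj₁ (refl , refl) , refl
far-consistent fx 0F = inj₂ (refl , refl) , refl
far-consistent fx 1F = refl
far-consistent fx 2F = refl
far-consistent fy 0F = inj₂ (refl , refl) , refl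
far-consistent fy 1F = refl
far-consistent fy 2F = refl
far-consistent fa 0F = inj₂ (refl , refl) , refl
far-consistent fa 1F = inj₁ (refl , refl) , refl
far-consistent fa 2F = refl
far-consistent fb 0F = inj₂ (refl , refl) , refl
far-consistent fb 1F = refl
far-consistent fb 2F = refl

glued-complete : ∀ {f} e → f isEndOf forkEnds e → ∃ λ i → ∃ λ g → ∃ λ j → far f i ≡ glued e g j
glued-complete zx (inj₁ refl) = 0F , fx , 0F , refl
glued-complete zx (inj₂ refl) = 0F , fz , 0F , refl
glued-complete zy (inj₁ refl) = 1F , fy , 0F , refl
glued-complete zy (inj₂ refl) = 0F , fz , 1F , refl
glued-complete za (inj₁ refl) = 2F , fa , 0F , refl
glued-complete za (inj₂ refl) = 0F , fz , 2F , refl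
glued-complete ab (inj₁ refl) = 1F , fb , 0F , refl
glued-complete ab (inj₂ refl) = 0F , fa , 1F , refl

outer-complete : ∀ h → ∃ λ i → far (foot h) i ≡ outer h
outer-complete hx = 1F , refl
outer-complete hy = 1F , refl
outer-complete hb = 1F , refl

-- The fork inside `K`

module ForkReduction
  (K K′ : Pseudohex) (noEnd : Pseudohex.NoEnd K) (A : FAddition K K′)
  (inner : ∀ e → F-no-edge K K′ A e →
           F-vertices K K′ A (proj₁ (Pseudohex.ends K e)) ×
           F-vertices K K′ A (proj₂ (Pseudohex.ends K e)))
  where

  open Pseudohex K
  open PseudohexProperties K
  open ForkAddition A using (attach; iso)
  open _≅_ iso using (vertices; edges; incident)

  private
    InF : Vertex → Set
    InF = F-vertices K K′ A

  place : Pseudohex.Hexagon K′ ⊎ ForkVertex → Hexagon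
  place = Inverse.to vertices

  place-injective : ∀ {p q} → place p ≡ place q → p ≡ q
  place-injective eq = trans (sym (Inverse.strictlyInverseʳ vertices _))
    (trans (cong (Inverse.from vertices) eq) (Inverse.strictlyInverseʳ vertices _))

  H : ForkVertex → Hexagon
  H f = place (inj₂ f)

  H-injective : ∀ {f g} → H f ≡ H g → f ≡ g
  H-injective eq with refl ← place-injective eq = refl

  link : ForkEdge ⊎ HalfEdge → Link
  link e = Inverse.to edges (inj₂ e)

  link-fork : ∀ e {f g} → forkEnds e ≐ (f , g) → linkEnds (link (inj₁ e)) ≐ (H f , H g)
  link-fork e e≐ = ≐-trans (incident (inj₂ (inj₁ e)))
    (≐-trans (≐-map place (≐-map inj₂ e≐)) ≐-refl)

  link-half : ∀ h → linkEnds (link (inj₂ h)) ≐ (H (foot h) , place (inj₁ (attach h)))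
  link-half h = incident (inj₂ (inj₂ h))

  -- Placing the ports

  private
    Placed : Far → Vertex → Set
    Placed (glued e _ _) v = OnLink (link (inj₁ e)) v
    Placed (outer h)     v = OnLink (link (inj₂ h)) v
    Placed loose         v = ⊤

    -- Names the antipodal pairs of `H f` by the ports of `f`. A bijection of three elements is a
    -- `spin`, so its effect on cyclic orders is the single bit `s`.
    Frame : ForkVertex → Set
    Frame f = ∃ λ a → ∃ λ s → ∀ i → Placed (far f i) (T (H f) (spin s a i))

    apart : ∀ k ℓ {h p q i j} → OnLink k (T h i) → OnLink ℓ (T h j) →
            linkEnds k ≐ (h , p) → linkEnds ℓ ≐ (h , q) → p ≢ q → i ≢ j
    apart k ℓ {h} on-k on-ℓ k≐ ℓ≐ p≢q refl = p≢q
      (trans (sym (OnLink-far k on-k k≐ (hexagonOf-T h _)))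
             (OnLink-far ℓ on-ℓ ℓ≐ (hexagonOf-T h _)))

    frame₂ : ∀ k ℓ {h p q} → linkEnds k ≐ (h , p) → linkEnds ℓ ≐ (h , q) → p ≢ q →
             ∃ λ a → ∃ λ s → OnLink k (T h a) × OnLink ℓ (T h (rot s a))
    frame₂ k ℓ k≐ ℓ≐ p≢q
      with a , on-a ← OnLink-T k (≐⇒isEndOf k≐) | b , on-b ← OnLink-T ℓ (≐⇒isEndOf ℓ≐)
      with s , refl ← ≢⇒rot (apart k ℓ on-a on-b k≐ ℓ≐ p≢q) = a , s , on-a , on-b

    place-≢ : ∀ {p q} → p ≢ q → place p ≢ place q
    place-≢ p≢q = p≢q ∘ place-injective

    abstract
      frame : ∀ f → Frame f
      frame fz
        with a , s , on-x , on-y ← frame₂ (link (inj₁ zx)) (link (inj₁ zy))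
               (link-fork zx ≐-refl) (link-fork zy ≐-refl) (place-≢ λ ())
           | c , on-a ← OnLink-T (link (inj₁ za)) (≐⇒isEndOf (link-fork za ≐-refl))
        -- The third link avoids the ports of the other two and so takes the remaining one.
        with refl ← rot-third s a
               (apart (link (inj₁ zx)) (link (inj₁ za)) on-x on-a
                 (link-fork zx ≐-refl) (link-fork za ≐-refl) (place-≢ λ ()))
               (apart (link (inj₁ zy)) (link (inj₁ za)) on-y on-a
                 (link-fork zy ≐-refl) (link-fork za ≐-refl) (place-≢ λ ())) =
        a , s , row on-x on-y on-a
      frame fx with a , s , on , on′ ← frame₂ (link (inj₁ zx)) (link (inj₂ hx))
                      (link-fork zx (≐-flip ≐-refl)) (link-half hx) (place-≢ λ ()) =
        a , s , row on on′ tt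
      frame fy with a , s , on , on′ ← frame₂ (link (inj₁ zy)) (link (inj₂ hy))
                      (link-fork zy (≐-flip ≐-refl)) (link-half hy) (place-≢ λ ()) =
        a , s , row on on′ tt
      frame fa with a , s , on , on′ ← frame₂ (link (inj₁ za)) (link (inj₁ ab))
                      (link-fork za (≐-flip ≐-refl)) (link-fork ab ≐-refl) (place-≢ λ ()) =
        a , s , row on on′ tt
      frame fb with a , s , on , on′ ← frame₂ (link (inj₁ ab)) (link (inj₂ hb))
                      (link-fork ab (≐-flip ≐-refl)) (link-half hb) (place-≢ λ ()) =
        a , s , row on on′ tt

    origin : ForkVertex → Fin 3
    origin f = proj₁ (frame f)

    sense : ForkVertex → Bool
    sense f = proj₁ (proj₂ (frame f))

  t : ForkVertex → Fin 3 → Vertex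
  t f i = T (H f) (spin (sense f) (origin f) i)

  private
    placed : ∀ f i → Placed (far f i) (t f i)
    placed f = proj₂ (proj₂ (frame f))

    placed-as : ∀ {f i x} → far f i ≡ x → Placed x (t f i)
    placed-as {f} {i} refl = placed f i

    consistent : ∀ {f i x} → far f i ≡ x → Consistent f i x
    consistent {f} {i} refl = far-consistent f i

  t-onto : ∀ f j → ∃ λ i → t f i ≡ T (H f) j
  t-onto f j with i , refl ← spin-onto (sense f) (origin f) j = i , refl

  -- Vertices of the fork as ports

  Port : Set
  Port = ForkVertex × Fin 3 × Bool

  vert : Port → Vertex
  vert (f , i , true)  = t f i
  vert (f , i , false) = bar (t f i)

  side-vert : ∀ f i b → side (vert (f , i , b)) ≡ b
  side-vert f i true  = side-T _ _
  side-vert f i false = trans (side-bar _) (cong not (side-T _ _))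

  hexagonOf-vert : ∀ f i b → hexagonOf (vert (f , i , b)) ≡ H f
  hexagonOf-vert f i true  = hexagonOf-T _ _
  hexagonOf-vert f i false = trans (hexagonOf-bar _) (hexagonOf-T _ _)

  private
    t-injective : ∀ {f i j} → t f i ≡ t f j → i ≡ j
    t-injective {f} eq = spin-injective _ _ _ _ (T-injective (H f) eq)

    bar-injective : ∀ {u v} → bar u ≡ bar v → u ≡ v
    bar-injective eq = trans (sym (bar-involutive _)) (trans (cong bar eq) (bar-involutive _))

    ω-injective : ∀ {u v} → ω u ≡ ω v → u ≡ v
    ω-injective eq = trans (sym (ω-involutive _)) (trans (cong ω eq) (ω-involutive _))

    index-injective : ∀ {f} b {i j} → vert (f , i , b) ≡ vert (f , j , b) → i ≡ j
    index-injective true  eq = t-injective eq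
    index-injective false eq = t-injective (bar-injective eq)

  vert-injective : ∀ {c d} → vert c ≡ vert d → c ≡ d
  vert-injective {f , i , b} {g , j , c} eq
    with refl ← H-injective (trans (sym (hexagonOf-vert f i b))
                  (trans (cong hexagonOf eq) (hexagonOf-vert g j c)))
       | refl ← trans (sym (side-vert f i b)) (trans (cong side eq) (side-vert g j c))
    with refl ← index-injective b eq = refl

  vert-cover : ∀ {v} → InF v → ∃ λ c → v ≡ vert c
  vert-cover {v} (f , f≡) with T-cover v
  ... | j , p rewrite sym f≡ with i , eq ← t-onto f j with p
  ...   | inj₁ v≡ = (f , i , true)  , trans v≡ (sym eq)
  ...   | inj₂ v≡ = (f , i , false) , trans v≡ (cong bar (sym eq))

  vert-InF : ∀ c → InF (vert c)
  vert-InF (f , i , b) = f , sym (hexagonOf-vert f i b)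

  -- White edges at the ports

  OnLink-vert : ∀ ℓ f i b → OnLink ℓ (t f i) → OnLink ℓ (vert (f , i , b))
  OnLink-vert ℓ f i true  on = on
  OnLink-vert ℓ f i false on = OnLink-bar ℓ on

  loose-or-linked : ∀ f i → far f i ≡ loose ⊎ ∃ λ e → OnLink (link e) (t f i)
  loose-or-linked f i with far f i | placed f i
  ... | glued e _ _ | on = inj₂ (inj₁ e , on)
  ... | outer h     | on = inj₂ (inj₂ h , on)
  ... | loose       | _  = inj₁ refl

  -- The partner is on the same link and in `H g`, so it is one of the two vertices of the far port;
  -- a white edge changes sides, which leaves the true one.
  glued-ω : ∀ {f i e g j} → far f i ≡ glued e g j → ω (bar (t f i)) ≡ t g j
  glued-ω {f} {i} {e} {g} {j} eq with e≐ , eq′ ← consistent {f} {i} eq =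
    case OnLink-unique ℓ (OnLink-ω ℓ on) (placed-as {g} {j} eq′)
           (trans (OnLink-far ℓ on (link-fork e e≐) (hexagonOf-vert f i false))
                  (sym (hexagonOf-vert g j true))) of λ
      { (inj₁ p) → p
      ; (inj₂ p) → contradiction
          (trans (sym (trans (side-ω _) (cong not (side-vert f i false))))
                 (trans (cong side p) (side-vert g j false)))
          λ () }
    where
    ℓ = link (inj₁ e)

    on : OnLink ℓ (bar (t f i))
    on = OnLink-bar ℓ (placed-as {f} {i} eq)

  outer-ω : ∀ {f i h} → far f i ≡ outer h → ∀ b → ¬ InF (ω (vert (f , i , b)))
  outer-ω {f} {i} {h} eq b (g , g≡) with refl ← consistent {f} {i} eq
    with () ← place-injective (trans g≡ (OnLink-far (link (inj₂ h))
                (OnLink-vert (link (inj₂ h)) f i b (placed-as {f} {i} eq))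
                (link-half h) (hexagonOf-vert f i b)))

  -- A real edge within `H f` would join the loose port to itself and be an end. One leading to
  -- another hexagon would be a link; but each link at `H f` comes from a fork edge or a half-edge
  -- and occupies a port that is not loose.
  loose-not-real : ∀ {f i} → far f i ≡ loose → ∀ b → ¬ Real (whiteAt (vert (f , i , b)))
  loose-not-real {f} {i} eq b r with hexagonOf (vert (f , i , b)) ≟ hexagonOf (ω (vert (f , i , b)))
  ... | yes same = within (vert-cover (f , trans (sym (hexagonOf-vert f i b)) same))
    where
    v = vert (f , i , b)

    within : ¬ ∃ λ c → ω v ≡ vert c
    within ((g , j , c) , ωv≡)
      with refl ← H-injective (trans (sym (hexagonOf-vert f i b)) (trans same
                    (trans (cong hexagonOf ωv≡) (hexagonOf-vert g j c))))
      with loose-or-linked f j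
    ... | inj₂ (e , on) = OnLink-loopless (link e) (OnLink-vert (link e) f j c on)
            (subst (λ w → hexagonOf w ≡ hexagonOf (ω w)) ωv≡
              (trans (sym same) (cong hexagonOf (sym (ω-involutive v)))))
    -- Both loose ports of `f` are port `2F`, so the edge joins that port to itself.
    ... | inj₁ eq′ with refl ← consistent {f} {i} eq | refl ← consistent {f} {j} eq′ =
            other b c (trans (sym (side-ω v)) (trans (cong side ωv≡) (side-vert f j c)))
              ωv≡
      where
      other : ∀ b c → not (side (vert (f , 2F , b))) ≡ c →
              ω (vert (f , 2F , b)) ≢ vert (f , 2F , c)
      other true  true  p _ with () ← trans (sym p) (cong not (side-vert f 2F true))
      other true  false _ p = ω≢bar noEnd _ p
      other false true  _ p = ω≢bar noEnd _ (trans p (sym (bar-involutive _)))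
      other false false p _ with () ← trans (sym p) (cong not (side-vert f 2F false))
  -- The isomorphism is onto the links, so `ℓ` is, up to passing to the mate, the image of an edge
  -- of the extended graph.
  ... | no diff = between (Inverse.from edges ℓ) (Inverse.strictlyInverseˡ edges ℓ)
    where
    v = vert (f , i , b)

    distinct : ∀ {p : Vertex × Vertex} → p ≐ (v , ω v) → hexagonOf (proj₁ p) ≢ hexagonOf (proj₂ p)
    distinct (inj₁ (refl , refl)) = diff
    distinct (inj₂ (refl , refl)) = diff ∘ sym

    ℓ : Link
    ℓ = whiteAt v , r , distinct (whiteAt-ends v)

    v∈ : v isEndOf ends (whiteAt v)
    v∈ = ≐⇒isEndOf (whiteAt-ends v)

    meets : ∀ {j} e → OnLink (link e) (t f j) → SameLink (link e) ℓ → j ≡ i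
    meets {j} e on same with OnLink-unique (link e)
      (OnLink-resp {ℓ} {link e} (SameLink-sym {link e} {ℓ} same) v∈)
      (OnLink-vert (link e) f j b on) (trans (hexagonOf-vert f i b) (sym (hexagonOf-vert f j b)))
    ... | inj₁ p with refl ← vert-injective {f , i , b} {f , j , b} p = refl
    ... | inj₂ p = opp b p
      where
      opp : ∀ b → vert (f , i , b) ≡ bar (vert (f , j , b)) → j ≡ i
      opp true  p with () ← vert-injective {f , i , true} {f , j , false} p
      opp false p with () ← vert-injective {f , i , false} {f , j , true} (trans p (bar-involutive _))

    end : ∀ e → SameLink (Inverse.to edges e) ℓ →
          H f isEndOf mapEnds place (Multigraph.ends (addFork (Pseudohex.hexagonGraph K′) attach) e)
    end e same = isEndOf-resp
      (≐-trans (≐-sym (linkEnds-cong {Inverse.to edges e} {ℓ} same)) (incident e))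
      (subst (_isEndOf linkEnds ℓ) (hexagonOf-vert f i b) (isEndOf-map hexagonOf v∈))

    fork-end : ∀ e → H f isEndOf mapEnds place (mapEnds inj₂ (forkEnds e)) → f isEndOf forkEnds e
    fork-end e (inj₁ p) = inj₁ (H-injective p)
    fork-end e (inj₂ p) = inj₂ (H-injective p)

    between : ∀ e → ¬ SameLink (Inverse.to edges e) ℓ
    between (inj₁ e) same with end (inj₁ e) same
    ... | inj₁ p with () ← place-injective p
    ... | inj₂ p with () ← place-injective p
    between (inj₂ (inj₁ e)) same
      with j , g , k , eq′ ← glued-complete {f} e
                               (fork-end e (end (inj₂ (inj₁ e)) same))
      with refl ← meets {j} (inj₁ e) (placed-as {f} {j} eq′) same
      with () ← trans (sym eq) eq′
    between (inj₂ (inj₂ h)) same with end (inj₂ (inj₂ h)) same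
    ... | inj₂ p with () ← place-injective p
    ... | inj₁ p with refl ← H-injective p
      with j , eq′ ← outer-complete h
      with refl ← meets {j} (inj₂ h) (placed-as {f} {j} eq′) same
      with () ← trans (sym eq) eq′

  -- The white edge here is derived, so by hypothesis both its ends are in the fork; the far port is
  -- loose too, because a port on a link carries a real edge.
  loose-ω : ∀ {f i} → far f i ≡ loose →
            ∃ λ g → ∃ λ j → far g j ≡ loose × ω (bar (t f i)) ≡ t g j
  loose-ω {f} {i} eq = located (vert-cover (far-end (whiteAt-ends v) (inner (whiteAt v)
    ((whiteAt-white v , loose-not-real {f} {i} eq false) , v , ≐⇒isEndOf (whiteAt-ends v) ,
     vert-InF (f , i , false)))))
    where
    v = bar (t f i)

    far-end : ∀ {p : Vertex × Vertex} → p ≐ (v , ω v) → InF (proj₁ p) × InF (proj₂ p) → InF (ω v)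
    far-end (inj₁ (_ , refl)) (_ , q) = q
    far-end (inj₂ (refl , _)) (p , _) = p

    located : (∃ λ c → ω v ≡ vert c) → ∃ λ g → ∃ λ j → far g j ≡ loose × ω v ≡ t g j
    located ((g , j , b) , p)
      with refl ← trans (sym (side-vert g j b)) (trans (cong side (sym p))
                    (trans (side-ω v) (cong not (side-vert f i false))))
      with loose-or-linked g j
    ... | inj₁ eq′     = g , j , eq′ , p
    ... | inj₂ (e , on) = contradiction
      (subst Real (trans (cong whiteAt (sym p)) (whiteAt-ω v)) (OnLink-real (link e) on))
      (loose-not-real {f} {i} eq false)

  -- Routings of the fork

  -- With the ports of f cyclically ordered by turn f, label f i names the
  -- contracted path through t f i.
  Carries : (ForkVertex → Bool) → (ForkVertex → Fin 3 → Vertex) → ForkVertex → Fin 3 → Far → Set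
  Carries turn label f i (glued _ g j) = label f (rot (not (turn f)) i) ≡ label g j
  Carries turn label f i (outer _)     = ⊤
  Carries turn label f i loose         =
    label f i ≡ t f i × label f (rot (not (turn f)) i) ≡ ω (bar (t f i))

  -- A certificate of safety: `carries` makes the label constant along every contracted path and
  -- makes it name the derived edge on that path by its true-side end, so that there can be only
  -- one.
  record Routing : Set where
    field
      turn    : ForkVertex → Bool
      label   : ForkVertex → Fin 3 → Vertex
      carries : ∀ f i → Carries turn label f i (far f i)

  -- From a routing to a safe reduction

  module _ (R : Routing) where
    open Routing R

    private
      orient : Hexagon → Bool
      orient h with Inverse.from vertices h
      -- Hexagons outside the fork are not reduced; the value is arbitrary.
      ... | inj₁ _ = true
      -- `matching h b` rotates in sense `not b`, and the frame translates the order `turn f` of the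
      -- ports into `turn f ⊙ sense f` in the hexagon.
      ... | inj₂ f = not (turn f ⊙ sense f)

      orient-H : ∀ f → orient (H f) ≡ not (turn f ⊙ sense f)
      orient-H f rewrite Inverse.strictlyInverseʳ vertices (inj₂ f) = refl

      N : Hexagon → Subset size
      N h = matching h (orient h)

      N-ends : ∀ {f e} → e ∈ N (H f) →
               ∃ λ i → ends e ≐ (t f i , bar (t f (rot (turn f) i)))
      N-ends {f} e∈ with j , e≐ ← matching-ends e∈ with i , refl ← spin-onto (sense f) (origin f) j =
        i , subst (λ k → _ ≐ (t f i , bar (T (H f) k)))
              (trans (cong (λ s → rot s (spin (sense f) (origin f) i))
                       (trans (cong not (orient-H f)) (not-involutive _)))
                     (spin-rot (turn f) (sense f) (origin f) i)) e≐

      -- The chosen matching joins the false-side vertex of a port to the true-side vertex of the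
      -- preceding port, from which it takes its label.
      portLabel : Port → Vertex
      portLabel (f , i , true)  = label f i
      portLabel (f , i , false) = label f (rot (not (turn f)) i)

      carries-as : ∀ {f i x} → far f i ≡ x → Carries turn label f i x
      carries-as {f} {i} refl = carries f i

      -- `carries` covers a glued port; an outer edge leaves the fork, so it cannot end at a port;
      -- at a loose port both labels are the true-side end of the derived edge.
      out-label : ∀ {f i g j} → ω (vert (f , i , false)) ≡ vert (g , j , true) →
                  portLabel (f , i , false) ≡ portLabel (g , j , true)
      out-label {f} {i} {g} {j} eq with far f i in at
      ... | glued e g′ j′ with refl ← vert-injective {g′ , j′ , true} {g , j , true}
                                        (trans (sym (glued-ω {f} {i} at)) eq) = carries-as {f} {i} at
      ... | outer h = contradiction (subst InF (sym eq) (vert-InF (g , j , true)))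
                        (outer-ω {f} {i} at false)
      ... | loose with g′ , j′ , at′ , p ← loose-ω {f} {i} at
        with refl ← vert-injective {g′ , j′ , true} {g , j , true} (trans (sym p) eq) =
        trans (proj₂ (carries-as {f} {i} at)) (trans p (sym (proj₁ (carries-as {g} {j} at′))))

      white-label : ∀ c d → ω (vert c) ≡ vert d → portLabel c ≡ portLabel d
      white-label (f , i , b) (g , j , c) eq
        with refl ← trans (sym (trans (side-ω _) (cong not (side-vert f i b))))
                      (trans (cong side eq) (side-vert g j c)) with b
      ... | false = out-label {f} {i} eq
      ... | true  = sym (out-label {g} {j} (trans (cong ω (sym eq)) (ω-involutive _)))

      -- The vertices on paths labelled `d`. The second alternative admits the white neighbours
      -- outside the fork, which are no ports.
      Near : Vertex → Vertex → Set
      Near d v = ∃ λ c → portLabel c ≡ d × (v ≡ vert c ⊎ v ≡ ω (vert c))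

      -- Any two ports that put `v` near a label are equal or white partners, and partners share a
      -- label.
      Near-unique : ∀ {d d′ v} → Near d v → Near d′ v → d ≡ d′
      Near-unique (c , refl , inj₁ refl) (c′ , refl , inj₁ p) =
        cong portLabel (vert-injective {c} {c′} p)
      Near-unique (c , refl , inj₁ refl) (c′ , refl , inj₂ p) = sym (white-label c′ c (sym p))
      Near-unique (c , refl , inj₂ refl) (c′ , refl , inj₁ p) = white-label c c′ p
      Near-unique (c , refl , inj₂ refl) (c′ , refl , inj₂ p) =
        cong portLabel (vert-injective {c} {c′} (ω-injective p))

      InN : Edge → Set
      InN = Contracted (F-hexagons K K′ A) N

      Near-vert : ∀ {d} c → Near d (vert c) → portLabel c ≡ d
      Near-vert c near = Near-unique (c , refl , inj₁ refl) near

      Near-step : ∀ {d u v e} → InN e → ends e ≐ (u , v) → Near d u → Near d v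
      Near-step (whiteᶜ we _) e≐ (c , l , inj₁ refl) =
        c , l , inj₂ (sym (ω-unique we e≐))
      Near-step (whiteᶜ we _) e≐ (c , l , inj₂ refl) =
        c , l , inj₁ (trans (sym (ω-unique we e≐)) (ω-involutive _))
      Near-step (blueᶜ h (f , refl) e∈) e≐ near with i , e≐′ ← N-ends e∈ =
        along (≐-trans (≐-sym e≐′) e≐) near
        where
        p q : Port
        p = f , i , true
        q = f , rot (turn f) i , false

        same : portLabel q ≡ portLabel p
        same = cong (label f) (rot-not-rot (turn f) i)

        along : ∀ {d u v} → (vert p , vert q) ≐ (u , v) → Near d u → Near d v
        along (inj₁ (refl , refl)) near = q , trans same (Near-vert p near) , inj₁ refl
        along (inj₂ (refl , refl)) near = p , trans (sym same) (Near-vert q near) , inj₁ refl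

      Near-star : ∀ {d u v} → Star (λ u v → ∃ λ e → InN e × ends e ≐ (u , v)) u v →
                  Near d u → Near d v
      Near-star ε                   near = near
      Near-star ((_ , e∈ , e≐) ◅ p) near = Near-star p (Near-step e∈ e≐ near)

      -- A contracted derived edge is named by its end on the true side.
      head : ∀ {e} → InN e → Derived e → ∃ λ d → d isEndOf ends e × Near d (proj₁ (ends e))
      head (blueᶜ h _ e∈) (we , _) with i , refl , _ ← ∈matching⁻ e∈
        with () ← trans (sym we) (blueEdge-blue (h , i))
      head {e} (whiteᶜ we (v , v∈ , v∈F)) (_ , ¬real)
        with (f , i , b) , refl ← vert-cover v∈F with loose-or-linked f i
      ... | inj₂ (l , on) = contradiction (subst Real (whiteAt-unique we v∈)
                              (OnLink-real (link l) (OnLink-vert (link l) f i b on))) ¬real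
      ... | inj₁ at = named b v∈
        where
        near : ∀ {g j} → far g j ≡ loose → ends e ≐ (t g j , ω (t g j)) → Near (t g j) (proj₁ (ends e))
        near {g} {j} at (inj₁ (p , _)) = (g , j , true) , proj₁ (carries-as {g} {j} at) , inj₁ p
        near {g} {j} at (inj₂ (p , _)) = (g , j , true) , proj₁ (carries-as {g} {j} at) , inj₂ p

        named : ∀ b → vert (f , i , b) isEndOf ends e →
                ∃ λ d → d isEndOf ends e × Near d (proj₁ (ends e))
        named true  v∈ = t f i , v∈ , near {f} {i} at (white-ends we v∈)
        named false v∈ with g , j , at′ , p ← loose-ω {f} {i} at =
          t g j , w∈ , near {g} {j} at′ (white-ends we w∈)
          where
          w∈ : t g j isEndOf ends e
          w∈ = subst (_isEndOf ends e) p (≐⇒isEndOf (≐-flip (white-ends we v∈)))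

    routing-safe : CanBeSafelyReduced (F-hexagons K K′ A)
    routing-safe = N , (λ h _ → matching-perfect h (orient h)) , safe
      where
      safe : SafeReduction (F-hexagons K K′ A) N
      safe e f e∈ f∈ de df path
        with d , d∈ , near ← head e∈ de | d′ , d′∈ , near′ ← head f∈ df
        with refl ← Near-unique (Near-star path near) near′ =
        trans (sym (whiteAt-unique (proj₁ de) d∈)) (whiteAt-unique (proj₁ df) d′∈)

  -- The embeddings of the fork

  private
    -- The names of the derived edges at the loose port of `f`: its true-side vertex itself, and the
    -- partner of its false-side vertex.
    into out : ForkVertex → Vertex
    into f = t f 2F
    out  f = ω (bar (t f 2F))

  -- In each routing, tracing the fork along the ports meets its seven leaves
  -- (loose ports and half-edges) in the stated cyclic order. Its only two
  -- consecutive loose ports are g and fx, where out fx ≡ into g, and the path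
  -- between them closes up to a cycle with a single derived edge.

  -- fa, hb, fb, hy, fy, fx, hx
  routing-y : out fx ≡ into fy → Routing
  routing-y eq = record { turn = turn ; label = label ; carries = carries }
    where
    turn : ForkVertex → Bool
    turn fx = false
    turn fy = true
    turn fz = false
    turn fa = false
    turn fb = true

    label : ForkVertex → Fin 3 → Vertex
    label fx = row (into fy) (out fa) (into fx)
    label fy = row (into fb) (out fy) (into fy)
    label fz = row (out fa) (into fy) (into fb)
    label fa = row (out fa) (into fb) (into fa)
    label fb = row (into fa) (out fb) (into fb)

    carries : ∀ f i → Carries turn label f i (far f i)
    -- Only the face between `fy` and `fx` meets two loose ends; `eq` identifies the derived edges
    -- there.
    carries fx = row refl tt (refl , sym eq)
    carries fy = row refl tt (refl , refl)
    carries fz = row refl refl refl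
    carries fa = row refl refl (refl , refl)
    carries fb = row refl tt (refl , refl)

  -- fa, hb, fb, fx, hx, fy, hy
  routing-b : out fx ≡ into fb → Routing
  routing-b eq = record { turn = turn ; label = label ; carries = carries }
    where
    turn : ForkVertex → Bool
    turn fx = false
    turn fy = false
    turn fz = true
    turn fa = false
    turn fb = true

    label : ForkVertex → Fin 3 → Vertex
    label fx = row (into fb) (out fy) (into fx)
    label fy = row (out fy) (out fa) (into fy)
    label fz = row (out fy) (out fa) (into fb)
    label fa = row (out fa) (into fb) (into fa)
    label fb = row (into fa) (out fb) (into fb)

    carries : ∀ f i → Carries turn label f i (far f i)
    carries fx = row refl tt (refl , sym eq)
    carries fy = row refl tt (refl , refl)
    carries fz = row refl refl refl
    carries fa = row refl refl (refl , refl)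
    carries fb = row refl tt (refl , refl)

  -- fb, hb, fa, fx, hx, fy, hy
  routing-a : out fx ≡ into fa → Routing
  routing-a eq = record { turn = turn ; label = label ; carries = carries }
    where
    turn : ForkVertex → Bool
    turn fx = false
    turn fy = false
    turn fz = true
    turn fa = true
    turn fb = false

    label : ForkVertex → Fin 3 → Vertex
    label fx = row (into fa) (out fy) (into fx)
    label fy = row (out fy) (out fb) (into fy)
    label fz = row (out fy) (out fb) (into fa)
    label fa = row (out fb) (out fa) (into fa)
    label fb = row (out fb) (out fa) (into fb)

    carries : ∀ f i → Carries turn label f i (far f i)
    carries fx = row refl tt (refl , sym eq)
    carries fy = row refl tt (refl , refl)
    carries fz = row refl refl refl
    carries fa = row refl refl (refl , refl)
    carries fb = row refl tt (refl , refl)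

  routing : Routing
  routing with g , j , at , eq ← loose-ω {fx} {2F} refl
    with refl ← consistent {g} {j} at with g
  -- The loose port of `fx` would be joined to itself by an end.
  ... | fx = contradiction (trans eq (sym (bar-involutive _))) (ω≢bar noEnd _)
  ... | fy = routing-y eq
  ... | fa = routing-a eq
  ... | fb = routing-b eq
  ... | fz with () ← at

mainTheorem6 : (K K′ : Pseudohex) → Pseudohex.Proper K → Pseudohex.Proper K′ →
    (A : FAddition K K′) →
    (∀ e → F-no-edge K K′ A e →
    F-vertices K K′ A (proj₁ (Pseudohex.ends K e)) ×
    F-vertices K K′ A (proj₂ (Pseudohex.ends K e))) →
    Pseudohex.CanBeSafelyReduced K (F-hexagons K K′ A)
mainTheorem6 K K′ (noEnd , _) _ A inner = routing-safe routing
  where open ForkReduction K K′ noEnd A inner
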